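{- For every odd prime power $q\notin\{5,7\}$ there exists an orthomorphism $\phi\in\mathscr{D}_{(q-1)/2}(q)$.
   Context: Let $\mathbb{F}_q$ be the finite field of order $q$. An orthomorphism is a permutation $\theta$ of $\mathbb{F}_q$ such that $x\mapsto\theta(x)-x$ is also a permutation. For $k\mid(q-1)$, fix a generator $g$ of $\mathbb{F}_q^*$ and let $C_{k,i}=\{g^j: j\equiv i\pmod k\}$, $0\le i<k$ (cyclotomy classes of index $k$). A cyclotomic map of index $k$ with multipliers $[a_0,\dots,a_{k-1}]$ is $\theta(0)=0$, $\theta(x)=a_ix$ for $x\in C_{k,i}$. $\mathscr{C}_k(q)$ is the set of orthomorphisms that are cyclotomic maps of index $k$, and $\mathscr{D}_k(q)=\mathscr{C}_k(q)\setminus\bigcup_{\ell<k,\ \ell\mid(q-1)}\mathscr{C}_\ell(q)$ (orthomorphisms of least index $k$). -}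

module Defs where

open import Data.Nat as ℕ using (ℕ; zero; suc; _%_)
open import Data.Nat.Divisibility using (_∣_)
open import Data.Fin using (Fin; toℕ)
open import Data.Product using (Σ; ∃; _×_; _,_)
open import Relation.Nullary using (¬_)
open import Relation.Binary.PropositionalEquality using (_≡_; _≢_)
open import Algebra.Structures using (IsCommutativeRing)
open import Function.Bundles using (_↔_)
open import Function.Definitions using (Bijective)

-- j mod k, where k is nonzero because Fin k is inhabited
modFin : ∀ {k} → ℕ → Fin k → ℕ
modFin {suc k} j _ = j % suc k

record FiniteField (q : ℕ) : Set₁ where
  infixl 7 _*_
  infixl 6 _+_ _-_
  field
    Carrier : Set
    _+_ _*_ : Carrier → Carrier → Carrier
    -_ : Carrier → Carrier
    0# 1# : Carrier
    isCommutativeRing : IsCommutativeRing _≡_ _+_ _*_ -_ 0# 1#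
    0≢1 : 0# ≢ 1#
    inverse : ∀ x → x ≢ 0# → ∃ λ y → x * y ≡ 1#
    enumeration : Fin q ↔ Carrier

  _-_ : Carrier → Carrier → Carrier
  x - y = x + (- y)

  _^_ : Carrier → ℕ → Carrier
  x ^ zero = 1#
  x ^ suc n = x * (x ^ n)

  IsGenerator : Carrier → Set
  IsGenerator g = g ≢ 0# × (∀ x → x ≢ 0# → ∃ λ j → g ^ j ≡ x)

  InClass : (g : Carrier) (k : ℕ) → Fin k → Carrier → Set
  InClass g k i x = ∃ λ j → (modFin j i ≡ toℕ i) × (g ^ j ≡ x)

  IsCyclotomicWith : (g : Carrier) (k : ℕ) → (Fin k → Carrier) → (Carrier → Carrier) → Set
  IsCyclotomicWith g k a θ = θ 0# ≡ 0# × (∀ i x → InClass g k i x → θ x ≡ a i * x)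

  IsCyclotomic : (g : Carrier) (k : ℕ) → (Carrier → Carrier) → Set
  IsCyclotomic g k θ = ∃ λ (a : Fin k → Carrier) → IsCyclotomicWith g k a θ

  IsOrthomorphism : (Carrier → Carrier) → Set
  IsOrthomorphism θ = Bijective _≡_ _≡_ θ × Bijective _≡_ _≡_ (λ x → θ x - x)

  InC : (g : Carrier) (k : ℕ) → (Carrier → Carrier) → Set
  InC g k θ = IsOrthomorphism θ × IsCyclotomic g k θ

  InD : (g : Carrier) (k : ℕ) → (Carrier → Carrier) → Set
  InD g k θ = InC g k θ × (∀ ℓ → ℓ ℕ.< k → ℓ ∣ (q ℕ.∸ 1) → ¬ InC g ℓ θ)

{-# OPTIONS --safe #-}

-- An odd map has index dividing (q - 1) / 2, and it has no smaller index when no c ≠ ±1 satisfies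
-- φ (c x) / (c x) = φ x / x for all x.  So an odd orthomorphism is wanted whose quotient φ x / x
-- determines x up to sign at sufficiently many places.
--
-- If the multiples of 1 form a proper subgroup V of F, choose u outside V and change x ↦ -x into
-- x ↦ ±2 - x on ±(u + V).
--
-- If every element is a multiple of 1, call 1, …, h positive, where q = 2h + 1.  On the positive
-- elements take x ↦ 1 - x; then 1 - x and 1 - 2x take, up to sign, every non-zero value once, except
-- that 1 - x takes the value 0 at x = 1 and misses 1/2.  To repair this put φ 1 = 1/2.  Now φ x - x is
-- -1/2 at x = 1 instead of -1, and it is ±1/2 also at the one positive e among 1/4 and 3/4; changing
-- the sign of φ e makes φ e - e = -1, which is the missing value.
module Submission where

open import Defs
open import Algebra.Bundles using (RawRing; CommutativeRing)
import Algebra.Properties.AbelianGroup as AbelianGroupProperties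
import Algebra.Properties.CommutativeMonoid.Sum as CommutativeMonoidSum
import Algebra.Properties.CommutativeSemigroup as CommutativeSemigroupProperties
import Algebra.Properties.Group as GroupProperties
import Algebra.Properties.Ring as RingProperties
import Algebra.Properties.Semiring.Mult as SemiringMult
import Algebra.Properties.Semiring.Mult.TCOptimised as SemiringMultOptimised
import Algebra.Solver.Ring as RingSolver
open import Algebra.Solver.Ring.AlmostCommutativeRing
  using (_-Raw-AlmostCommutative⟶_; fromCommutativeRing)
open import Data.Fin as Fin using (Fin; zero; suc; toℕ; fromℕ<; punchOut)
open import Data.Fin.Permutation using (Permutation′; permutation)
open import Data.Fin.Properties as Fin
  using (any?; all?; injective⇒≤; pigeonhole; punchOut-injective; ¬∀⟶∃¬; toℕ-fromℕ<; toℕ<n; toℕ-injective)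
open import Data.Maybe using (Maybe; just; nothing)
open import Data.Nat as ℕ using (ℕ; zero; suc; _∸_; _/_; _%_; _≤_; _<_; z≤n; s≤s; NonZero)
open import Data.Nat.DivMod using (m≡m%n+[m/n]*n; m%n<n; [m+n]%n≡m%n; m*n/n≡m)
open import Data.Nat.Divisibility using (_∣_; 0∣⇒≡0)
import Data.Nat.Properties as ℕ
open import Data.Product using (∃; _×_; _,_; proj₁; proj₂)
open import Data.Sum using (_⊎_; inj₁; inj₂; [_,_]′)
open import Function using (_∘_; _↔_; Inverse; Injective; Bijective)
open import Level using (0ℓ)
open import Relation.Binary.Definitions using (DecidableEquality)
open import Relation.Binary.PropositionalEquality as ≡ using (_≡_; _≢_)
import Relation.Binary.Reasoning.Setoid as SetoidReasoning
open import Relation.Nullary using (Dec; yes; no; ¬_; ¬?; contradiction)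
open import Relation.Nullary.Decidable using (map′; decidable-stable; _⊎-dec_)
open import Relation.Unary using (Decidable)

-- A ring solver with integer coefficients.

-- (a , b) stands for a - b.  The case b = 0 is separated, and the optimised multiple is
-- used, so that the constants 0, 1, 1 + 1, … of the ring are definitionally denotations.
module DifferenceSolver {c ℓ} (R : CommutativeRing c ℓ) where
  open CommutativeRing R
  open AbelianGroupProperties +-abelianGroup using (⁻¹-∙-comm; ⁻¹-anti-homo‿-; ε⁻¹≈ε)
  open CommutativeSemigroupProperties +-commutativeSemigroup using (interchange)
  open RingProperties ring using (x[y-z]≈xy-xz; [y-z]x≈yx-zx; -‿distribˡ-*)
  open SemiringMult semiring using (×-homo-+; ×1-homo-*) renaming (_×_ to _·_)
  open SemiringMultOptimised semiring using (×ᵤ≈×) renaming (_×_ to _·′_)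
  open SetoidReasoning setoid

  -- Leaves each integer a single normal form, so coefficients can be compared by plain equality of
  -- pairs.
  reduce : ℕ × ℕ → ℕ × ℕ
  reduce (suc a , suc b) = reduce (a , b)
  reduce x = x

  rawDifferences : RawRing 0ℓ 0ℓ
  rawDifferences = record
    { Carrier = ℕ × ℕ
    ; _≈_ = _≡_
    ; _+_ = λ { (a , b) (c , d) → reduce (a ℕ.+ c , b ℕ.+ d) }
    ; _*_ = λ { (a , b) (c , d) → reduce (a ℕ.* c ℕ.+ b ℕ.* d , b ℕ.* c ℕ.+ a ℕ.* d) }
    ; -_ = λ { (a , b) → b , a }
    ; 0# = 0 , 0
    ; 1# = 1 , 0
    }

  private module D = RawRing rawDifferences

  denote : ℕ × ℕ → Carrier
  denote (a , zero) = a ·′ 1#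
  denote (a , suc b) = a ·′ 1# - suc b ·′ 1#

  value : ℕ × ℕ → Carrier
  value (a , b) = a · 1# - b · 1#

  denote≈value : ∀ x → denote x ≈ value x
  denote≈value (a , zero) = begin
    a ·′ 1#            ≈⟨ ×ᵤ≈× a 1# ⟨
    a · 1#             ≈⟨ +-identityʳ _ ⟨
    a · 1# + 0#        ≈⟨ +-congˡ ε⁻¹≈ε ⟨
    a · 1# - 0#        ∎
  denote≈value (a , suc b) = sym (+-cong (×ᵤ≈× a 1#) (-‿cong (×ᵤ≈× (suc b) 1#)))

  +-interchange : ∀ a b c d → (a + c) - (b + d) ≈ (a - b) + (c - d)
  +-interchange a b c d = trans (+-congˡ (sym (⁻¹-∙-comm b d))) (interchange a c (- b) (- d))

  value-reduce : ∀ x → value (reduce x) ≈ value x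
  value-reduce (zero , b) = refl
  value-reduce (suc a , zero) = refl
  value-reduce (suc a , suc b) = begin
    value (reduce (a , b))                       ≈⟨ value-reduce (a , b) ⟩
    value (a , b)                                ≈⟨ +-identityˡ _ ⟨
    0# + value (a , b)                           ≈⟨ +-congʳ (-‿inverseʳ 1#) ⟨
    (1# - 1#) + value (a , b)                    ≈⟨ +-interchange _ _ _ _ ⟨
    (1# + a · 1#) - (1# + b · 1#)                ∎

  value-+ : ∀ x y → value (x D.+ y) ≈ value x + value y
  value-+ (a , b) (c , d) = begin
    value (reduce (a ℕ.+ c , b ℕ.+ d))           ≈⟨ value-reduce (a ℕ.+ c , b ℕ.+ d) ⟩
    (a ℕ.+ c) · 1# - (b ℕ.+ d) · 1#              ≈⟨ +-cong (×-homo-+ 1# a c) (-‿cong (×-homo-+ 1# b d)) ⟩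
    (a · 1# + c · 1#) - (b · 1# + d · 1#)        ≈⟨ +-interchange _ _ _ _ ⟩
    (a · 1# - b · 1#) + (c · 1# - d · 1#)        ∎

  value-neg : ∀ x → value (D.- x) ≈ - value x
  value-neg (a , b) = sym (⁻¹-anti-homo‿- _ _)

  value-* : ∀ x y → value (x D.* y) ≈ value x * value y
  value-* (a , b) (c , d) = begin
    value (reduce (a ℕ.* c ℕ.+ b ℕ.* d , b ℕ.* c ℕ.+ a ℕ.* d))
      ≈⟨ value-reduce (a ℕ.* c ℕ.+ b ℕ.* d , b ℕ.* c ℕ.+ a ℕ.* d) ⟩
    (a ℕ.* c ℕ.+ b ℕ.* d) · 1# - (b ℕ.* c ℕ.+ a ℕ.* d) · 1#
      ≈⟨ +-cong (×-homo-+ 1# (a ℕ.* c) _) (-‿cong (×-homo-+ 1# (b ℕ.* c) _)) ⟩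
    ((a ℕ.* c) · 1# + (b ℕ.* d) · 1#) - ((b ℕ.* c) · 1# + (a ℕ.* d) · 1#)
      ≈⟨ +-cong (+-cong (×1-homo-* a c) (×1-homo-* b d)) (-‿cong (+-cong (×1-homo-* b c) (×1-homo-* a d))) ⟩
    (A * C + B * D) - (B * C + A * D)
      ≈⟨ +-interchange _ _ _ _ ⟩
    (A * C - B * C) + (B * D - A * D)
      ≈⟨ +-cong ([y-z]x≈yx-zx C A B) ([y-z]x≈yx-zx D B A) ⟨
    (A - B) * C + (B - A) * D
      ≈⟨ +-congˡ (*-congʳ (⁻¹-anti-homo‿- A B)) ⟨
    (A - B) * C + - (A - B) * D
      ≈⟨ +-congˡ (-‿distribˡ-* (A - B) D) ⟨
    (A - B) * C - (A - B) * D
      ≈⟨ x[y-z]≈xy-xz (A - B) C D ⟨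
    (A - B) * (C - D) ∎
    where
    A = a · 1#
    B = b · 1#
    C = c · 1#
    D = d · 1#

  morphism : rawDifferences -Raw-AlmostCommutative⟶ fromCommutativeRing R
  morphism = record
    { ⟦_⟧ = denote
    ; +-homo = λ x y → via (x D.+ y) (value-+ x y) (+-cong (denote≈value x) (denote≈value y))
    ; *-homo = λ x y → via (x D.* y) (value-* x y) (*-cong (denote≈value x) (denote≈value y))
    ; -‿homo = λ x → trans (denote≈value (D.- x)) (trans (value-neg x) (-‿cong (sym (denote≈value x))))
    ; 0-homo = refl
    ; 1-homo = refl
    }
    where
    via : ∀ z {u v} → value z ≈ v → u ≈ v → denote z ≈ u
    via z p q = trans (denote≈value z) (trans p (sym q))

  _≟_ : ∀ x y → Maybe (denote x ≈ denote y)
  (a , b) ≟ (c , d) with a ℕ.≟ c | b ℕ.≟ d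
  ... | yes ≡.refl | yes ≡.refl = just refl
  -- In positive characteristic distinct integers may denote equal elements, so no inequality is
  -- claimed.
  ... | _ | _ = nothing

  open RingSolver rawDifferences (fromCommutativeRing R) morphism _≟_ public

  infix 10 #_
  #_ : ∀ {m} → ℕ → Polynomial m
  # k = con (k , 0)

-- Injections, surjections and the pigeonhole principle on finite sets.

open ≡ using (refl; sym; trans; cong; cong₂; subst; module ≡-Reasoning)

-- A missed value `y` could be punched out of the codomain, leaving an injection from `Fin (suc n)`
-- into `Fin n`.
fin-injective⇒surjective : ∀ {n} (f : Fin n → Fin n) → Injective _≡_ _≡_ f → ∀ y → ∃ λ x → f x ≡ y
fin-injective⇒surjective {suc n} f f-injective y with any? (λ x → f x Fin.≟ y)
... | yes found = found
... | no ∄x = contradiction (injective⇒≤ avoid-injective) ℕ.1+n≰n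
  where
  y≢f : ∀ x → y ≢ f x
  y≢f x y≡fx = ∄x (x , sym y≡fx)
  avoid-injective : Injective _≡_ _≡_ (λ x → punchOut (y≢f x))
  avoid-injective eq = f-injective (punchOut-injective (y≢f _) (y≢f _) eq)

module Enumerated {q} {A : Set} (enumeration : Fin q ↔ A) where
  open Inverse enumeration

  to∘from : ∀ x → to (from x) ≡ x
  to∘from x = inverseˡ refl

  from-injective : Injective _≡_ _≡_ from
  from-injective {x} {y} eq = trans (sym (to∘from x)) (trans (cong to eq) (to∘from y))

  infix 4 _≟_
  _≟_ : DecidableEquality A
  x ≟ y = map′ from-injective (cong from) (from x Fin.≟ from y)

  surjective⇒≤ : ∀ {m} (f : Fin m → A) → (∀ y → ∃ λ x → f x ≡ y) → q ≤ m
  surjective⇒≤ f f-surjective = injective⇒≤ {f = section} section-injective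
    where
    section : Fin q → Fin _
    section i = proj₁ (f-surjective (to i))
    section-injective : Injective _≡_ _≡_ section
    section-injective {i} {j} eq = trans (sym (inverseʳ refl)) (trans
      (cong from (trans (sym (proj₂ (f-surjective (to i)))) (trans (cong f eq) (proj₂ (f-surjective (to j))))))
      (inverseʳ refl))

  -- A section of `f`, read on `Fin q`, is injective and hence surjective. So every `a` is a chosen
  -- preimage, and the section is a two-sided inverse.
  surjective⇒injective : (f : Fin q → A) → (∀ y → ∃ λ x → f x ≡ y) → Injective _≡_ _≡_ f
  surjective⇒injective f f-surjective {a} {b} fa≡fb =
    trans (sym (section∘f a)) (trans (cong section fa≡fb) (section∘f b))
    where
    section : A → Fin q
    section y = proj₁ (f-surjective y)
    f∘section : ∀ y → f (section y) ≡ y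
    f∘section y = proj₂ (f-surjective y)
    section∘to-injective : Injective _≡_ _≡_ (section ∘ to)
    section∘to-injective {i} {j} eq = trans (sym (inverseʳ refl)) (trans
      (cong from (trans (sym (f∘section (to i))) (trans (cong f eq) (f∘section (to j)))))
      (inverseʳ refl))
    section∘f : ∀ a → section (f a) ≡ a
    section∘f a with i , refl ← fin-injective⇒surjective (section ∘ to) section∘to-injective a =
      cong section (f∘section (to i))

  surjective⇒bijective : (f : A → A) → (∀ y → ∃ λ x → f x ≡ y) → Bijective _≡_ _≡_ f
  surjective⇒bijective f f-surjective = f-injective , λ y →
    proj₁ (f-surjective y) , λ { refl → proj₂ (f-surjective y) }
    where
    f∘to-injective = surjective⇒injective (f ∘ to) λ y →
      from (proj₁ (f-surjective y)) , trans (cong f (to∘from _)) (proj₂ (f-surjective y))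
    f-injective : Injective _≡_ _≡_ f
    f-injective {x} {y} eq = from-injective (f∘to-injective
      (trans (cong f (to∘from x)) (trans eq (sym (cong f (to∘from y))))))

-- If every `k` had a label, two of them would share one. Decidability of `R` extracts a label from
-- the failed search.
∃-unlabelled : ∀ {m n} {R : Fin n → Fin m → Set} → m < n → (∀ k l → Dec (R k l)) →
  (∀ {k k′ l} → R k l → R k′ l → k ≡ k′) → ∃ λ k → ∀ l → ¬ R k l
∃-unlabelled {m} {n} {R} m<n R? R-injective with any? (λ k → all? (λ l → ¬? (R? k l)))
... | yes found = found
... | no all-labelled = contradiction (proj₂ (proj₂ collision)) λ { (k<k′ , eq) →
    Fin.<⇒≢ k<k′ (R-injective (subst (R _) eq (proj₂ (label _))) (proj₂ (label _))) }
  where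
  label : ∀ k → ∃ (R k)
  label k with l , ¬¬Rkl ← ¬∀⟶∃¬ m _ (λ l → ¬? (R? k l)) (λ unlabelled → all-labelled (k , unlabelled)) =
    l , decidable-stable (R? k l) ¬¬Rkl
  collision = pigeonhole m<n (proj₁ ∘ label)

-- Arithmetic in a finite field.

module FiniteFieldProperties {q} (F : FiniteField q) where
  open FiniteField F hiding (_-_) public

  commutativeRing : CommutativeRing _ _
  commutativeRing = record { isCommutativeRing = isCommutativeRing }

  open CommutativeRing commutativeRing public
    using (_-_; +-identityʳ; +-comm; -‿inverseʳ; *-identityˡ; *-identityʳ; *-comm; *-assoc; zeroʳ)
  open CommutativeRing commutativeRing using (semiring; +-group; +-commutativeMonoid)
  open Enumerated enumeration public
  open GroupProperties +-group public
    using () renaming (⁻¹-involutive to -‿involutive; ε⁻¹≈ε to -0≡0)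
  open SemiringMult semiring using (×-homo-+; ×1-homo-*) renaming (_×_ to _·_)
  open DifferenceSolver commutativeRing public hiding (_≟_)
  open ≡-Reasoning

  -- Turns the use of a hypothesis l ≡ r into an identity for the ring solver.
  combine : ∀ {a b l r} c → l ≡ r → a ≡ b + c * (l - r) → a ≡ b
  combine {b = b} {l} c refl eq = trans eq (solve 3 (λ b c l → b :+ c :* (l :- l) := b) refl b c l)

  *-cancelˡ : ∀ {x y z} → x ≢ 0# → x * y ≡ x * z → y ≡ z
  *-cancelˡ {x} {y} {z} x≢0 xy≡xz with x⁻¹ , xx⁻¹≡1 ← inverse x x≢0 = begin
    y                ≡⟨ *-identityˡ y ⟨
    1# * y           ≡⟨ cong (_* y) xx⁻¹≡1 ⟨
    (x * x⁻¹) * y    ≡⟨ solve 3 (λ x i y → (x :* i) :* y := i :* (x :* y)) refl x x⁻¹ y ⟩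
    x⁻¹ * (x * y)    ≡⟨ cong (x⁻¹ *_) xy≡xz ⟩
    x⁻¹ * (x * z)    ≡⟨ solve 3 (λ x i y → i :* (x :* y) := (x :* i) :* y) refl x x⁻¹ z ⟩
    (x * x⁻¹) * z    ≡⟨ cong (_* z) xx⁻¹≡1 ⟩
    1# * z           ≡⟨ *-identityˡ z ⟩
    z                ∎

  *-≢0 : ∀ {x y} → x ≢ 0# → y ≢ 0# → x * y ≢ 0#
  *-≢0 {x} x≢0 y≢0 xy≡0 = y≢0 (*-cancelˡ x≢0 (trans xy≡0 (sym (zeroʳ x))))

  *-zero-factor : ∀ {x y} → x * y ≡ 0# → x ≡ 0# ⊎ y ≡ 0#
  *-zero-factor {x} {y} xy≡0 with x ≟ 0#
  ... | yes x≡0 = inj₁ x≡0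
  ... | no x≢0 = inj₂ (*-cancelˡ x≢0 (trans xy≡0 (sym (zeroʳ x))))

  square≡1 : ∀ {x} → x * x ≡ 1# → x ≡ 1# ⊎ x ≡ - 1#
  square≡1 {x} xx≡1 with *-zero-factor {x - 1#} {x + 1#}
    (combine 1# xx≡1 (solve 1 (λ x → (x :- # 1) :* (x :+ # 1) := # 0 :+ # 1 :* (x :* x :- # 1)) refl x))
  ... | inj₁ x-1≡0 = inj₁ (combine 1# x-1≡0 (solve 1 (λ x → x := # 1 :+ # 1 :* (x :- # 1 :- # 0)) refl x))
  ... | inj₂ x+1≡0 = inj₂ (combine 1# x+1≡0 (solve 1 (λ x → x := :- # 1 :+ # 1 :* (x :+ # 1 :- # 0)) refl x))

  ι : ℕ → Carrier
  ι k = k · 1#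

  ι-+ : ∀ m n → ι (m ℕ.+ n) ≡ ι m + ι n
  ι-+ = ×-homo-+ 1#

  ι-* : ∀ m n → ι (m ℕ.* n) ≡ ι m * ι n
  ι-* = ×1-homo-*

  -- Translation by 1 permutes the field, so the sum of all elements does not change when q · 1 is added to it.
  ι-q≡0 : ι q ≡ 0#
  ι-q≡0 = combine 1# total (solve 2 (λ s k → k := # 0 :+ # 1 :* (s :+ k :- s)) refl (sum to) (ι q))
    where
    open Inverse enumeration
    open CommutativeMonoidSum +-commutativeMonoid
    translation : Permutation′ q
    translation = permutation (λ i → from (to i + 1#)) (λ i → from (to i - 1#))
      (λ i → trans (cong (λ x → from (x + 1#)) (to∘from _))
        (trans (cong from (solve 1 (λ x → x :- # 1 :+ # 1 := x) refl (to i))) (inverseʳ refl)))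
      (λ i → trans (cong (λ x → from (x - 1#)) (to∘from _))
        (trans (cong from (solve 1 (λ x → x :+ # 1 :- # 1 := x) refl (to i))) (inverseʳ refl)))
    total : sum to + ι q ≡ sum to
    total = sym (begin
      sum to                                ≡⟨ sum-permute to translation ⟩
      sum (λ i → to (from (to i + 1#)))     ≡⟨ sum-cong-≗ {q} (λ i → to∘from (to i + 1#)) ⟩
      sum (λ i → to i + 1#)                 ≡⟨ ∑-distrib-+ to (λ _ → 1#) ⟩
      sum to + sum (λ (_ : Fin q) → 1#)     ≡⟨ cong (sum to +_) (sum-replicate q) ⟩
      sum to + ι q                          ∎)

  ι-*q≡0 : ∀ k → ι (k ℕ.* q) ≡ 0#
  ι-*q≡0 k = trans (ι-* k q) (trans (cong (ι k *_) ι-q≡0) (zeroʳ _))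

-- Fields of odd order: halving and odd maps.

module OddOrderField {h} (F : FiniteField (suc (h ℕ.+ h))) where
  open FiniteFieldProperties F public

  -- Multiples of q vanish. Being a multiple of 1 thereby becomes a search over `Fin q`, whatever
  -- the characteristic.
  ι-% : ∀ k → ι (k % suc (h ℕ.+ h)) ≡ ι k
  ι-% k = sym (begin
    ι k                                      ≡⟨ cong ι (m≡m%n+[m/n]*n k q) ⟩
    ι (k % q ℕ.+ k / q ℕ.* q)                ≡⟨ ι-+ (k % q) _ ⟩
    ι (k % q) + ι (k / q ℕ.* q)              ≡⟨ cong (ι (k % q) +_) (ι-*q≡0 (k / q)) ⟩
    ι (k % q) + 0#                           ≡⟨ +-identityʳ _ ⟩
    ι (k % q)                                ∎)
    where
    open ≡-Reasoning
    q = suc (h ℕ.+ h)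

  -- This is 1/2, because 2(h + 1) = q + 1 and q vanishes in the field.
  half : Carrier
  half = ι (suc h)

  half+half≡1 : half + half ≡ 1#
  half+half≡1 = begin
    half + half                         ≡⟨ ι-+ (suc h) (suc h) ⟨
    ι (suc h ℕ.+ suc h)                 ≡⟨ cong (ι ∘ suc) (ℕ.+-suc h h) ⟩
    1# + ι (suc (h ℕ.+ h))              ≡⟨ cong (1# +_) ι-q≡0 ⟩
    1# + 0#                             ≡⟨ +-identityʳ 1# ⟩
    1#                                  ∎
    where open ≡-Reasoning

  -- 2h = q - 1 becomes -1. In the prime case -1/2 is therefore the last of the positive elements 1,
  -- ..., h.
  ι-h≡-half : ι h ≡ - half
  ι-h≡-half = combine 1# (half+half≡1)
    (solve 1 (λ x → x := :- (# 1 :+ x) :+ # 1 :* ((# 1 :+ x) :+ (# 1 :+ x) :- # 1)) refl (ι h))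

  x+x≡0⇒x≡0 : ∀ {x} → x + x ≡ 0# → x ≡ 0#
  x+x≡0⇒x≡0 {x} x+x≡0 = combine half x+x≡0 (combine (- x) half+half≡1
    (solve 2 (λ x t → x := # 0 :+ t :* (x :+ x :- # 0) :+ (:- x) :* (t :+ t :- # 1)) refl x half))

  halve : ∀ {x y} → x + x ≡ y + y → x ≡ y
  halve {x} {y} 2x≡2y = combine half 2x≡2y (combine (y - x) half+half≡1 (solve 3
    (λ t x y → x := y :+ t :* (x :+ x :- (y :+ y)) :+ (y :- x) :* (t :+ t :- # 1)) refl half x y))

  module OddMap {θ : Carrier → Carrier} (θ-odd : ∀ x → θ (- x) ≡ - θ x) where

    θ0≡0 : θ 0# ≡ 0#
    θ0≡0 = x+x≡0⇒x≡0 (combine 1# (trans (cong θ (sym -0≡0)) (θ-odd 0#))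
      (solve 1 (λ t → t :+ t := # 0 :+ # 1 :* (t :- :- t)) refl (θ 0#)))

    -id-odd : ∀ x → θ (- x) - - x ≡ - (θ x - x)
    -id-odd x = combine 1# (θ-odd x)
      (solve 3 (λ x t t′ → t′ :- :- x := :- (t :- x) :+ # 1 :* (t′ :- :- t)) refl x (θ x) (θ (- x)))

    -- If `x` is sent to `- y`, then `- x` is sent to `y`; the coverage arguments can thus ignore
    -- signs.
    surjective-up-to-sign : (∀ y → ∃ λ x → θ x ≡ y ⊎ θ x ≡ - y) → ∀ y → ∃ λ x → θ x ≡ y
    surjective-up-to-sign covered y with covered y
    ... | x , inj₁ θx≡y = x , θx≡y
    ... | x , inj₂ θx≡-y = - x , trans (θ-odd x) (trans (cong (-_) θx≡-y) (-‿involutive y))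

  -- The order of a generator.

  module Generated {g} (g-generates : IsGenerator g) where
    open ≡-Reasoning

    ^-+ : ∀ m n → g ^ (m ℕ.+ n) ≡ g ^ m * g ^ n
    ^-+ zero n = sym (*-identityˡ _)
    ^-+ (suc m) n = trans (cong (g *_) (^-+ m n)) (sym (*-assoc g (g ^ m) (g ^ n)))

    ^-≢0 : ∀ k → g ^ k ≢ 0#
    ^-≢0 zero = 0≢1 ∘ sym
    ^-≢0 (suc k) = *-≢0 (proj₁ g-generates) (^-≢0 k)

    ^-*≡1 : ∀ {d} k → g ^ d ≡ 1# → g ^ (k ℕ.* d) ≡ 1#
    ^-*≡1 zero _ = refl
    ^-*≡1 {d} (suc k) g^d≡1 = begin
      g ^ (d ℕ.+ k ℕ.* d)      ≡⟨ ^-+ d (k ℕ.* d) ⟩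
      g ^ d * g ^ (k ℕ.* d)    ≡⟨ cong₂ _*_ g^d≡1 (^-*≡1 k g^d≡1) ⟩
      1# * 1#                  ≡⟨ *-identityˡ 1# ⟩
      1#                       ∎

    zero∷powers : ∀ {d} → Fin (suc d) → Carrier
    zero∷powers zero = 0#
    zero∷powers (suc i) = g ^ toℕ i

    -- With period `d`, exponents reduce modulo `d`, so 0 and the first `d` powers exhaust all 2h +
    -- 1 elements.
    period-lower-bound : ∀ {d} → .{{_ : NonZero d}} → g ^ d ≡ 1# → h ℕ.+ h ≤ d
    period-lower-bound {d} g^d≡1 = ℕ.≤-pred (surjective⇒≤ (zero∷powers {d}) covered)
      where
      covered : ∀ y → ∃ λ i → zero∷powers {d} i ≡ y
      covered y with y ≟ 0#
      ... | yes y≡0 = zero , sym y≡0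
      ... | no y≢0 with j , g^j≡y ← proj₂ g-generates y y≢0 = suc (fromℕ< (m%n<n j d)) , (begin
        g ^ toℕ (fromℕ< (m%n<n j d))             ≡⟨ cong (g ^_) (toℕ-fromℕ< (m%n<n j d)) ⟩
        g ^ (j % d)                              ≡⟨ *-identityʳ _ ⟨
        g ^ (j % d) * 1#                         ≡⟨ cong (g ^ (j % d) *_) (^-*≡1 (j / d) g^d≡1) ⟨
        g ^ (j % d) * g ^ (j / d ℕ.* d)          ≡⟨ ^-+ (j % d) _ ⟨
        g ^ (j % d ℕ.+ j / d ℕ.* d)              ≡⟨ cong (g ^_) (m≡m%n+[m/n]*n j d) ⟨
        g ^ j                                    ≡⟨ g^j≡y ⟩
        y                                        ∎)

    -- The q + 1 entries 0, g^0, ..., g^(q-1) must collide. No power is 0, so two powers agree, and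
    -- their exponents differ by at most 2h.
    short-period : ∃ λ d → 0 < d × d ≤ h ℕ.+ h × g ^ d ≡ 1#
    short-period with pigeonhole (ℕ.n<1+n (suc (h ℕ.+ h))) (Inverse.from enumeration ∘ zero∷powers)
    ... | zero , suc j , _ , eq = contradiction (sym (from-injective eq)) (^-≢0 (toℕ j))
    ... | suc i , suc j , s≤s i<j , eq =
      toℕ j ∸ toℕ i , ℕ.m<n⇒0<n∸m i<j , ℕ.≤-trans (ℕ.m∸n≤m (toℕ j) (toℕ i)) (ℕ.≤-pred (toℕ<n j)) ,
      *-cancelˡ (^-≢0 (toℕ i)) (begin
        g ^ toℕ i * g ^ (toℕ j ∸ toℕ i)      ≡⟨ ^-+ (toℕ i) _ ⟨
        g ^ (toℕ i ℕ.+ (toℕ j ∸ toℕ i))      ≡⟨ cong (g ^_) (ℕ.m+[n∸m]≡n (ℕ.<⇒≤ i<j)) ⟩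
        g ^ toℕ j                            ≡⟨ from-injective eq ⟨
        g ^ toℕ i                            ≡⟨ *-identityʳ _ ⟨
        g ^ toℕ i * 1#                       ∎)

    -- The short period is at most 2h, and every positive period is at least 2h.
    g^2h≡1 : g ^ (h ℕ.+ h) ≡ 1#
    g^2h≡1 with d , 0<d , d≤2h , g^d≡1 ← short-period
      with refl ← ℕ.≤-antisym d≤2h (period-lower-bound {{ℕ.>-nonZero 0<d}} g^d≡1) = g^d≡1

    g^h≡±1 : g ^ h ≡ 1# ⊎ g ^ h ≡ - 1#
    g^h≡±1 = square≡1 (trans (sym (^-+ h h)) g^2h≡1)

    ^-*h : ∀ t x → g ^ (t ℕ.* h) * x ≡ x ⊎ g ^ (t ℕ.* h) * x ≡ - x
    ^-*h zero x = inj₁ (*-identityˡ x)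
    ^-*h (suc t) x with ^-*h t x | g^h≡±1
    ... | ih | sign = subst (λ y → y ≡ x ⊎ y ≡ - x)
      (trans (sym (*-assoc (g ^ h) _ x)) (cong (_* x) (sym (^-+ h (t ℕ.* h))))) (flip ih sign)
      where
      flip : ∀ {s y} → y ≡ x ⊎ y ≡ - x → s ≡ 1# ⊎ s ≡ - 1# → s * y ≡ x ⊎ s * y ≡ - x
      flip (inj₁ refl) (inj₁ refl) = inj₁ (*-identityˡ x)
      flip (inj₂ refl) (inj₁ refl) = inj₂ (*-identityˡ _)
      flip (inj₁ refl) (inj₂ refl) = inj₂ (solve 1 (λ x → (:- # 1) :* x := :- x) refl x)
      flip (inj₂ refl) (inj₂ refl) = inj₁ (solve 1 (λ x → (:- # 1) :* (:- x) := x) refl x)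

    modFin-split : ∀ {k} j (i : Fin k) → ∃ λ t → j ≡ modFin j i ℕ.+ t ℕ.* k
    modFin-split {suc k} j i = j / suc k , m≡m%n+[m/n]*n j (suc k)

    -- Odd maps as cyclotomic maps of index h.

    module _ {θ : Carrier → Carrier} (θ-odd : ∀ x → θ (- x) ≡ - θ x) where

      -- Exponents in one class differ by multiples of `h`, and `g ^ h` is 1 or -1. So a class
      -- contains only ±g^i, and an odd map has the same quotient θ x / x at both.
      odd⇒cyclotomic : IsCyclotomic g h θ
      odd⇒cyclotomic = multiplier , OddMap.θ0≡0 θ-odd , agrees
        where
        multiplier : Fin h → Carrier
        multiplier i = θ (g ^ toℕ i) * proj₁ (inverse (g ^ toℕ i) (^-≢0 (toℕ i)))
        at-power : ∀ i → θ (g ^ toℕ i) ≡ multiplier i * (g ^ toℕ i)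
        at-power i with g⁻ⁱ , inverseʳ ← inverse (g ^ toℕ i) (^-≢0 (toℕ i)) =
          sym (combine (θ (g ^ toℕ i)) inverseʳ
            (solve 3 (λ t y x → t :* y :* x := t :+ t :* (x :* y :- # 1)) refl (θ (g ^ toℕ i)) g⁻ⁱ (g ^ toℕ i)))
        agrees : ∀ i x → InClass g h i x → θ x ≡ multiplier i * x
        agrees i x (j , j≡i , g^j≡x) with t , j≡ ← modFin-split j i =
          [ (λ eq → at (trans x≡ eq)) , (λ eq → at- (trans x≡ eq)) ]′ (^-*h t (g ^ toℕ i))
          where
          x≡ : x ≡ g ^ (t ℕ.* h) * (g ^ toℕ i)
          x≡ = begin
            x                                ≡⟨ g^j≡x ⟨
            g ^ j                            ≡⟨ cong (g ^_) j≡ ⟩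
            g ^ (modFin j i ℕ.+ t ℕ.* h)     ≡⟨ cong (λ m → g ^ (m ℕ.+ t ℕ.* h)) j≡i ⟩
            g ^ (toℕ i ℕ.+ t ℕ.* h)          ≡⟨ ^-+ (toℕ i) _ ⟩
            g ^ toℕ i * g ^ (t ℕ.* h)        ≡⟨ *-comm _ _ ⟩
            g ^ (t ℕ.* h) * g ^ toℕ i        ∎
          at : x ≡ g ^ toℕ i → θ x ≡ multiplier i * x
          at refl = at-power i
          at- : x ≡ - (g ^ toℕ i) → θ x ≡ multiplier i * x
          at- refl = begin
            θ (- (g ^ toℕ i))                      ≡⟨ θ-odd _ ⟩
            - θ (g ^ toℕ i)                        ≡⟨ cong (-_) (at-power i) ⟩
            - (multiplier i * (g ^ toℕ i))         ≡⟨ solve 2 (λ m x → :- (m :* x) := m :* (:- x)) refl (multiplier i) _ ⟩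
            multiplier i * - (g ^ toℕ i)           ∎

      -- Multiplication by `g ^ ℓ` preserves the classes of index `ℓ`, hence the multiplier θ x / x;
      -- the equation is cross-multiplied to avoid division.
      cyclotomic⇒invariant : ∀ {ℓ} .{{_ : NonZero ℓ}} → IsCyclotomic g ℓ θ →
        ∀ x → x ≢ 0# → θ (g ^ ℓ * x) * x ≡ g ^ ℓ * x * θ x
      cyclotomic⇒invariant {ℓ@(suc _)} (a , _ , agrees) x x≢0 with j , g^j≡x ← proj₂ g-generates x x≢0 = begin
        θ (g ^ ℓ * x) * x          ≡⟨ cong (_* x) (agrees i (g ^ ℓ * x) (j ℕ.+ ℓ , trans ([m+n]%n≡m%n j ℓ) j≡i , shifted)) ⟩
        a i * (g ^ ℓ * x) * x      ≡⟨ solve 3 (λ a s x → a :* (s :* x) :* x := s :* x :* (a :* x)) refl (a i) (g ^ ℓ) x ⟩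
        g ^ ℓ * x * (a i * x)      ≡⟨ cong (g ^ ℓ * x *_) (agrees i x (j , j≡i , g^j≡x)) ⟨
        g ^ ℓ * x * θ x            ∎
        where
        i : Fin ℓ
        i = fromℕ< (m%n<n j ℓ)
        j≡i : j % ℓ ≡ toℕ i
        j≡i = sym (toℕ-fromℕ< (m%n<n j ℓ))
        shifted : g ^ (j ℕ.+ ℓ) ≡ g ^ ℓ * x
        shifted = trans (^-+ j ℓ) (trans (*-comm _ _) (cong (g ^ ℓ *_) g^j≡x))

      -- An index `ℓ` below `h` would put `g ^ ℓ` in the stabiliser of θ x / x, so it would be 1 or
      -- -1; then `ℓ` or 2ℓ would be a period shorter than 2h. Surjectivity gives bijectivity since
      -- the field is finite.
      oddOrthomorphism⇒InD : 0 < h →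
        (∀ y → ∃ λ x → θ x ≡ y) → (∀ y → ∃ λ x → θ x - x ≡ y) →
        (∀ c → c ≢ 0# → (∀ x → x ≢ 0# → θ (c * x) * x ≡ c * x * θ x) → c ≡ 1# ⊎ c ≡ - 1#) →
        InD g h θ
      oddOrthomorphism⇒InD 0<h θ-surjective θ-id-surjective stabiliser =
        ((surjective⇒bijective θ θ-surjective , surjective⇒bijective (λ x → θ x - x) θ-id-surjective) , odd⇒cyclotomic) ,
        no-smaller-index
        where
        no-smaller-index : ∀ ℓ → ℓ < h → ℓ ∣ h ℕ.+ h → ¬ InC g ℓ θ
        -- Zero divides only 0, whereas q - 1 = 2h is positive.
        no-smaller-index zero _ 0∣2h _ = ℕ.<-irrefl (sym (0∣⇒≡0 0∣2h)) (ℕ.m≤n⇒m≤o+n h 0<h)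
        no-smaller-index ℓ@(suc _) ℓ<h _ (_ , cyclotomic) with stabiliser (g ^ ℓ) (^-≢0 ℓ) (cyclotomic⇒invariant cyclotomic)
        ... | inj₁ g^ℓ≡1 = ℕ.<⇒≱ ℓ<h (ℕ.≤-trans (ℕ.m≤m+n h h) (period-lower-bound g^ℓ≡1))
        ... | inj₂ g^ℓ≡-1 = ℕ.<⇒≱ (ℕ.+-mono-< ℓ<h ℓ<h) (period-lower-bound (begin
          g ^ (ℓ ℕ.+ ℓ)      ≡⟨ ^-+ ℓ ℓ ⟩
          g ^ ℓ * g ^ ℓ      ≡⟨ cong₂ _*_ g^ℓ≡-1 g^ℓ≡-1 ⟩
          - 1# * - 1#        ≡⟨ solve 0 ((:- # 1) :* (:- # 1) := # 1) refl ⟩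
          1#                 ∎))

-- Extending a map oddly from a set disjoint from its negative.

module OddExtension {h} (F : FiniteField (suc (h ℕ.+ h))) where
  open OddOrderField {h} F

  module _ {P : Carrier → Set} (P? : Decidable P) (P⇒¬P- : ∀ {x} → P x → ¬ P (- x)) (f : Carrier → Carrier) where

    oddExtension : Carrier → Carrier
    oddExtension x with P? x | P? (- x)
    ... | yes _ | _ = f x
    ... | no _ | yes _ = - f (- x)
    -- The default is the odd orthomorphism x ↦ -x. In the prime case only 0 reaches it.
    ... | no _ | no _ = - x

    on-P : ∀ {x} → P x → oddExtension x ≡ f x
    on-P {x} Px with P? x
    ... | yes _ = refl
    ... | no ¬Px = contradiction Px ¬Px

    on-neg-P : ∀ {x} → P (- x) → oddExtension x ≡ - f (- x)
    on-neg-P {x} P-x with P? x | P? (- x)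
    ... | yes Px | _ = contradiction P-x (P⇒¬P- Px)
    ... | no _ | yes _ = refl
    ... | no _ | no ¬P-x = contradiction P-x ¬P-x

    elsewhere : ∀ {x} → ¬ P x → ¬ P (- x) → oddExtension x ≡ - x
    elsewhere {x} ¬Px ¬P-x with P? x | P? (- x)
    ... | yes Px | _ = contradiction Px ¬Px
    ... | no _ | yes P-x = contradiction P-x ¬P-x
    ... | no _ | no _ = refl

    oddExtension-odd : ∀ x → oddExtension (- x) ≡ - oddExtension x
    oddExtension-odd x with P? x | P? (- x)
    ... | yes Px | yes P-x = contradiction P-x (P⇒¬P- Px)
    ... | no _ | yes _ = sym (-‿involutive _)
    ... | yes Px | no _ with P? (- - x)
    ...   | yes _ = cong (λ y → - f y) (-‿involutive x)
    ...   | no ¬P--x = contradiction (subst P (sym (-‿involutive x)) Px) ¬P--x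
    oddExtension-odd x | no ¬Px | no _ with P? (- - x)
    ...   | yes P--x = contradiction (subst P (-‿involutive x) P--x) ¬Px
    ...   | no _ = refl

-- Fields with an element outside the prime field.

module NonPrimeField {h} (F : FiniteField (suc (h ℕ.+ h))) where
  open OddOrderField {h} F
  open OddExtension {h} F

  module _ {g} (g-generates : IsGenerator g) (0<h : 0 < h) {u : Carrier} (u∉ι : ∀ k → ι k ≢ u) where
    open Generated g-generates

    u+ι : Carrier → Set
    u+ι x = ∃ λ k → u + ι k ≡ x

    u+ι? : Decidable u+ι
    u+ι? x = map′ (λ { (i , eq) → toℕ i , eq })
      (λ { (k , eq) → fromℕ< (m%n<n k _) , trans (cong (u +_) (trans (cong ι (toℕ-fromℕ< (m%n<n k _))) (ι-% k))) eq })
      (any? λ i → (u + ι (toℕ i)) ≟ x)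

    -- The preimages needed below are shifts by 1 or 2, and these must stay in the coset.
    u+ι-suc : ∀ {x} → u+ι x → u+ι (x + 1#)
    u+ι-suc (k , refl) = suc k , solve 2 (λ u x → u :+ (# 1 :+ x) := u :+ x :+ # 1) refl u (ι k)

    -- A common point x = u + k = -(u + l) would give u = -(k + l) / 2, a multiple of 1.
    u+ι⇒¬u+ι- : ∀ {x} → u+ι x → ¬ u+ι (- x)
    u+ι⇒¬u+ι- {x} (k , u+k≡x) (l , u+l≡-x) = u∉ι (suc h ℕ.* (h ℕ.+ h) ℕ.* (k ℕ.+ l)) (begin
      -- The factor `suc h` maps to 1/2 and `h ℕ.+ h` to -1, so this natural number stands for -(k +
      -- l) / 2.
      ι (suc h ℕ.* (h ℕ.+ h) ℕ.* (k ℕ.+ l))             ≡⟨ ι-* (suc h ℕ.* (h ℕ.+ h)) _ ⟩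
      ι (suc h ℕ.* (h ℕ.+ h)) * ι (k ℕ.+ l)             ≡⟨ cong₂ _*_ (ι-* (suc h) (h ℕ.+ h)) (ι-+ k l) ⟩
      half * ι (h ℕ.+ h) * (ι k + ι l)                  ≡⟨ combine (half * (ι k + ι l)) ι-q≡0 (solve 4
                                                              (λ t m k l → t :* m :* (k :+ l) := (:- t) :* (k :+ l) :+ t :* (k :+ l) :* ((# 1 :+ m) :- # 0))
                                                              refl half (ι (h ℕ.+ h)) (ι k) (ι l)) ⟩
      - half * (ι k + ι l)                              ≡⟨ cong (- half *_) k+l≡-2u ⟩
      - half * (- u - u)                                ≡⟨ combine u half+half≡1 (solve 2
                                                              (λ t u → (:- t) :* (:- u :- u) := u :+ u :* (t :+ t :- # 1)) refl half u) ⟩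
      u                                                 ∎)
      where
      open ≡-Reasoning
      k+l≡-2u : ι k + ι l ≡ - u - u
      k+l≡-2u = combine 1# u+k≡x (combine 1# u+l≡-x (solve 4
        (λ u k l x → k :+ l := :- u :- u :+ # 1 :* (u :+ k :- x) :+ # 1 :* (u :+ l :- :- x)) refl u (ι k) (ι l) x))

    u≢0 : u ≢ 0#
    u≢0 = u∉ι 0 ∘ sym

    φ : Carrier → Carrier
    φ = oddExtension u+ι? u+ι⇒¬u+ι- (λ x → 1# + 1# - x)

    φ-odd : ∀ x → φ (- x) ≡ - φ x
    φ-odd = oddExtension-odd u+ι? u+ι⇒¬u+ι- _

    φ-on-coset : ∀ {x} → u+ι x → φ x ≡ 1# + 1# - x
    φ-on-coset = on-P u+ι? u+ι⇒¬u+ι- _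

    φ-on-neg-coset : ∀ {x} → u+ι (- x) → φ x ≡ - (1# + 1# - - x)
    φ-on-neg-coset = on-neg-P u+ι? u+ι⇒¬u+ι- _

    φ-elsewhere : ∀ {x} → ¬ u+ι x → ¬ u+ι (- x) → φ x ≡ - x
    φ-elsewhere = elsewhere u+ι? u+ι⇒¬u+ι- _

    -- On the coset, 2 - x equals -y or y at x = y + 2 or x = -y + 2; this preimage is in the coset
    -- when y or -y respectively is.
    φ-covers : ∀ y → ∃ λ x → φ x ≡ y ⊎ φ x ≡ - y
    φ-covers y with u+ι? y | u+ι? (- y)
    ... | yes Wy | _ = y + 1# + 1# , inj₂ (trans (φ-on-coset (u+ι-suc (u+ι-suc Wy)))
      (solve 1 (λ y → # 1 :+ # 1 :- (y :+ # 1 :+ # 1) := :- y) refl y))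
    ... | no _ | yes W-y = - y + 1# + 1# , inj₁ (trans (φ-on-coset (u+ι-suc (u+ι-suc W-y)))
      (solve 1 (λ y → # 1 :+ # 1 :- (:- y :+ # 1 :+ # 1) := y) refl y))
    ... | no ¬Wy | no ¬W-y = y , inj₂ (φ-elsewhere ¬Wy ¬W-y)

    -- The difference is 2 - 2x on the coset and -2x off its two signed copies, so the case
    -- distinction is on y/2 and the shift is by 1.
    φ-id-covers : ∀ y → ∃ λ x → φ x - x ≡ y ⊎ φ x - x ≡ - y
    φ-id-covers y with u+ι? (half * y) | u+ι? (- (half * y))
    ... | yes W | _ = half * y + 1# , inj₂ (trans (cong (_- _) (φ-on-coset (u+ι-suc W)))
      (combine (- y) half+half≡1 (solve 2
        (λ t y → # 1 :+ # 1 :- (t :* y :+ # 1) :- (t :* y :+ # 1) := :- y :+ (:- y) :* (t :+ t :- # 1)) refl half y)))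
    ... | no _ | yes W- = - (half * y) + 1# , inj₁ (trans (cong (_- _) (φ-on-coset (u+ι-suc W-)))
      (combine y half+half≡1 (solve 2
        (λ t y → # 1 :+ # 1 :- (:- (t :* y) :+ # 1) :- (:- (t :* y) :+ # 1) := y :+ y :* (t :+ t :- # 1)) refl half y)))
    ... | no ¬W | no ¬W- = half * y , inj₂ (trans (cong (_- _) (φ-elsewhere ¬W ¬W-))
      (combine (- y) half+half≡1 (solve 2
        (λ t y → :- (t :* y) :- (t :* y) := :- y :+ (:- y) :* (t :+ t :- # 1)) refl half y)))

    -- Testing invariance at the single point `u`, where φ u = 2 - u, is enough; `v` is the value
    -- that the branch containing `c * u` prescribes.
    at-u : ∀ c {v} → (∀ x → x ≢ 0# → φ (c * x) * x ≡ c * x * φ x) → φ (c * u) ≡ v → c * u * (1# + 1# - u) ≡ v * u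
    at-u c invariant refl = sym (trans (invariant u u≢0) (cong (c * u *_) (φ-on-coset (0 , +-identityʳ u))))

    -- φ x / x + 1 equals ±2 / x on ±(u + ι) and vanishes elsewhere, hence determines x up to sign there.
    φ-stabiliser : ∀ c → c ≢ 0# → (∀ x → x ≢ 0# → φ (c * x) * x ≡ c * x * φ x) → c ≡ 1# ⊎ c ≡ - 1#
    φ-stabiliser c c≢0 invariant with u+ι? (c * u) | u+ι? (- (c * u))
    ... | yes W | _ = inj₁ (*-cancelˡ u≢0 (trans (*-comm u c) (halve (combine 1# (at-u c invariant (φ-on-coset W)) (solve 2
      (λ u c → c :* u :+ c :* u := u :* # 1 :+ u :* # 1 :+ # 1 :* (c :* u :* (# 1 :+ # 1 :- u) :- (# 1 :+ # 1 :- c :* u) :* u))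
      refl u c)))))
    ... | no _ | yes W- = inj₂ (*-cancelˡ u≢0 (trans (*-comm u c) (halve (combine 1# (at-u c invariant (φ-on-neg-coset W-)) (solve 2
      (λ u c → c :* u :+ c :* u := u :* (:- # 1) :+ u :* (:- # 1) :+ # 1 :* (c :* u :* (# 1 :+ # 1 :- u) :- (:- (# 1 :+ # 1 :- :- (c :* u))) :* u))
      refl u c)))))
    ... | no ¬W | no ¬W- = contradiction (x+x≡0⇒x≡0 (combine 1# (at-u c invariant (φ-elsewhere ¬W ¬W-)) (solve 2
      (λ u c → c :* u :+ c :* u := # 0 :+ # 1 :* (c :* u :* (# 1 :+ # 1 :- u) :- (:- (c :* u)) :* u)) refl u c)))
      (*-≢0 c≢0 u≢0)

    nonPrime-InD : InD g h φ
    nonPrime-InD = oddOrthomorphism⇒InD φ-odd 0<h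
      (OddMap.surjective-up-to-sign φ-odd φ-covers) (OddMap.surjective-up-to-sign (OddMap.-id-odd φ-odd) φ-id-covers)
      φ-stabiliser

-- Prime order: positive and negative elements.

module PrimeField {h} (F : FiniteField (suc (h ℕ.+ h)))
  (ι-covers : ∀ x → ∃ λ (i : Fin (suc (h ℕ.+ h))) → FiniteFieldProperties.ι F (toℕ i) ≡ x) where
  open OddOrderField {h} F
  open OddExtension {h} F
  open ≡-Reasoning

  -- A surjection from `Fin q` onto q elements is injective.
  ι-injective : ∀ {m n} → m ≤ h ℕ.+ h → n ≤ h ℕ.+ h → ι m ≡ ι n → m ≡ n
  ι-injective {m} {n} m≤2h n≤2h eq = trans (sym (toℕ-fromℕ< (s≤s m≤2h))) (trans
    (cong toℕ (surjective⇒injective (ι ∘ toℕ) ι-covers (trans (cong ι (toℕ-fromℕ< (s≤s m≤2h)))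
      (trans eq (sym (cong ι (toℕ-fromℕ< (s≤s n≤2h))))))))
    (toℕ-fromℕ< (s≤s n≤2h)))

  ι-suc≢0 : ∀ {k} → k < h ℕ.+ h → ι (suc k) ≢ 0#
  ι-suc≢0 k<2h eq = contradiction (ι-injective k<2h z≤n eq) λ ()

  Pos : Carrier → Set
  Pos x = ∃ λ (i : Fin h) → ι (suc (toℕ i)) ≡ x

  Pos? : Decidable Pos
  Pos? x = any? λ i → ι (suc (toℕ i)) ≟ x

  Pos-ι : ∀ {k} → k < h → Pos (ι (suc k))
  Pos-ι k<h = fromℕ< k<h , cong (ι ∘ suc) (toℕ-fromℕ< k<h)

  -- Two representatives from 1, ..., h have a sum between 2 and 2h, which is not 0 modulo q.
  Pos⇒¬Pos- : ∀ {x} → Pos x → ¬ Pos (- x)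
  Pos⇒¬Pos- {x} (i , i≡x) (j , j≡-x) = ι-suc≢0 (ℕ.+-mono-<-≤ (toℕ<n i) (toℕ<n j)) (begin
    ι (suc (toℕ i) ℕ.+ suc (toℕ j))        ≡⟨ ι-+ (suc (toℕ i)) _ ⟩
    ι (suc (toℕ i)) + ι (suc (toℕ j))      ≡⟨ cong₂ _+_ i≡x j≡-x ⟩
    x - x                                  ≡⟨ -‿inverseʳ x ⟩
    0#                                     ∎)

  ¬Pos0 : ¬ Pos 0#
  ¬Pos0 Pos0 = Pos⇒¬Pos- Pos0 (subst Pos (sym -0≡0) Pos0)

  trichotomy : ∀ x → x ≡ 0# ⊎ Pos x ⊎ Pos (- x)
  trichotomy x with ι-covers x
  ... | zero , 0≡x = inj₁ (sym 0≡x)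
  ... | suc i , i≡x with toℕ i ℕ.<? h
  ...   | yes i<h = inj₂ (inj₁ (subst Pos i≡x (Pos-ι i<h)))
  ...   | no i≮h = inj₂ (inj₂ (subst Pos complement (Pos-ι m<h)))
    where
    -- `suc m` is q minus the representative of `x`, hence represents `- x`; `Pos` counts from 1, so
    -- the bound needed is `m < h`.
    m = h ℕ.+ h ∸ suc (toℕ i)
    m<h : m < h
    m<h = ℕ.+-cancelʳ-< (suc (toℕ i)) m h (subst (_< h ℕ.+ suc (toℕ i)) (sym (ℕ.m∸n+n≡m (toℕ<n i)))
      (ℕ.+-monoʳ-< h (s≤s (ℕ.≮⇒≥ i≮h))))
    complement : ι (suc m) ≡ - x
    complement = combine 1# sum≡0 (solve 2 (λ m x → m := :- x :+ # 1 :* (m :+ x :- # 0)) refl (ι (suc m)) x)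
      where
      sum≡0 : ι (suc m) + x ≡ 0#
      sum≡0 = begin
        ι (suc m) + x                     ≡⟨ cong (ι (suc m) +_) i≡x ⟨
        ι (suc m) + ι (suc (toℕ i))       ≡⟨ ι-+ (suc m) (suc (toℕ i)) ⟨
        ι (suc (m ℕ.+ suc (toℕ i)))       ≡⟨ cong (ι ∘ suc) (ℕ.m∸n+n≡m (toℕ<n i)) ⟩
        ι (suc (h ℕ.+ h))                 ≡⟨ ι-q≡0 ⟩
        0#                                ∎

  -- Adding 1 leaves the positive elements only from h, which is -1/2.
  Pos-suc : ∀ {x} → Pos x → x ≢ - half → Pos (x + 1#)
  Pos-suc {x} (i , i≡x) x≢-half = subst Pos (trans (+-comm 1# _) (cong (_+ 1#) i≡x))
    (Pos-ι (ℕ.≤∧≢⇒< (toℕ<n i) λ 1+i≡h → x≢-half (trans (sym i≡x) (trans (cong ι 1+i≡h) ι-h≡-half))))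

  Pos-half : 0 < h → Pos (- half)
  Pos-half 0<h = subst Pos (trans (cong ι (ℕ.suc-pred h {{ℕ.>-nonZero 0<h}})) ι-h≡-half) (Pos-ι (ℕ.≤-reflexive (ℕ.suc-pred h {{ℕ.>-nonZero 0<h}})))

  -- If -y is positive, 1 - y is its successor, and only -y = -1/2 has no positive successor. This
  -- selects 1/4 or 3/4, and later the positive solution of 2x = 1 + y or 2x = 1 - y.
  Pos-or-complement : ∀ {y} → y ≢ 0# → y ≢ half → Pos y ⊎ Pos (1# - y)
  Pos-or-complement {y} y≢0 y≢half with trichotomy y
  ... | inj₁ y≡0 = contradiction y≡0 y≢0
  ... | inj₂ (inj₁ Pos-y) = inj₁ Pos-y
  ... | inj₂ (inj₂ Pos-neg-y) = inj₂ (subst Pos (+-comm (- y) 1#)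
    (Pos-suc Pos-neg-y λ -y≡-half → y≢half (trans (sym (-‿involutive y)) (trans (cong (-_) -y≡-half) (-‿involutive half)))))

  covers-from-Pos : ∀ {θ : Carrier → Carrier} → (∀ x → θ (- x) ≡ - θ x) →
    (∀ y → Pos y → ∃ λ x → θ x ≡ y ⊎ θ x ≡ - y) → ∀ y → ∃ λ x → θ x ≡ y
  covers-from-Pos {θ} θ-odd covered = surjective-up-to-sign up-to-sign
    where
    open OddMap θ-odd
    up-to-sign : ∀ y → ∃ λ x → θ x ≡ y ⊎ θ x ≡ - y
    up-to-sign y with trichotomy y
    ... | inj₁ refl = 0# , inj₁ θ0≡0
    ... | inj₂ (inj₁ Pos-y) = covered y Pos-y
    ... | inj₂ (inj₂ Pos-neg-y) with covered (- y) Pos-neg-y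
    ...   | x , inj₁ θx≡-y = x , inj₂ θx≡-y
    ...   | x , inj₂ θx≡--y = x , inj₁ (trans θx≡--y (-‿involutive y))

  -- The repaired map x ↦ 1 - x for prime q of at least 11.

  module Large (5≤h : 5 ≤ h) {g} (g-generates : IsGenerator g) where
    open Generated g-generates

    0<h : 0 < h
    0<h = ℕ.≤-trans (s≤s z≤n) 5≤h

    Pos1 : Pos 1#
    Pos1 = subst Pos (+-identityʳ 1#) (Pos-ι 0<h)

    half≢0 : half ≢ 0#
    half≢0 half≡0 = ¬Pos0 (subst Pos (trans (cong (-_) half≡0) -0≡0) (Pos-half 0<h))

    ¬Pos-half : ¬ Pos half
    ¬Pos-half Pos-h = Pos⇒¬Pos- Pos-h (Pos-half 0<h)

    half≢1 : half ≢ 1#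
    half≢1 half≡1 = ¬Pos-half (subst Pos (sym half≡1) Pos1)

    -- Otherwise 4 = 1 and so 3 = 0. This keeps 1/4 apart from 1.
    half≢2 : half ≢ 1# + 1#
    half≢2 half≡2 = ι-suc≢0 (ℕ.≤-trans (ℕ.≤-trans (s≤s (s≤s (s≤s z≤n))) 5≤h) (ℕ.m≤m+n h h))
      (combine (1# + 1#) (sym half≡2) (combine 1# half+half≡1 (solve 1
        (λ t → # 1 :+ (# 1 :+ (# 1 :+ # 0)) := # 0 :+ (# 1 :+ # 1) :* (# 1 :+ # 1 :- t) :+ # 1 :* (t :+ t :- # 1)) refl half)))

    quarter : Carrier
    quarter = half * half

    quarter+quarter≡half : quarter + quarter ≡ half
    quarter+quarter≡half = combine half half+half≡1 (solve 1 (λ t → t :* t :+ t :* t := t :+ t :* (t :+ t :- # 1)) refl half)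

    quarter≢half : quarter ≢ half
    quarter≢half quarter≡half = half≢1 (*-cancelˡ half≢0 (trans quarter≡half (sym (*-identityʳ half))))

    complement≢1 : ∀ {x} → x ≢ 0# → 1# - x ≢ 1#
    complement≢1 {x} x≢0 1-x≡1 = x≢0 (combine (- 1#) 1-x≡1
      (solve 1 (λ x → x := # 0 :+ (:- # 1) :* (# 1 :- x :- # 1)) refl x))

    double-complement : ∀ {x} → x + x ≡ half → (1# - x) + (1# - x) ≡ 1# + half
    double-complement {x} x+x≡half = combine (- 1#) x+x≡half (combine (- 1#) half+half≡1 (solve 2
      (λ t x → (# 1 :- x) :+ (# 1 :- x) := # 1 :+ t :+ (:- # 1) :* (x :+ x :- t) :+ (:- # 1) :* (t :+ t :- # 1)) refl half x))

    -- Whichever of 1/4 and 3/4 is positive.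
    exceptional : ∃ λ e → Pos e × e ≢ 1# × (e + e ≡ half ⊎ e + e ≡ 1# + half)
    exceptional = [
      (λ Pos-e → quarter , Pos-e ,
        (λ e≡1 → half≢2 (trans (sym quarter+quarter≡half) (cong₂ _+_ e≡1 e≡1))) , inj₁ quarter+quarter≡half) ,
      (λ Pos-e → 1# - quarter , Pos-e ,
        complement≢1 (*-≢0 half≢0 half≢0) , inj₂ (double-complement quarter+quarter≡half)) ]′
      (Pos-or-complement (*-≢0 half≢0 half≢0) quarter≢half)

    -- Each coincidence forces y = 1/2 or y = -1/2; the former is not positive and the latter is
    -- excluded. With z = 2x, this keeps generic preimages away from the exceptional point.
    unexceptional : ∀ {y z} → Pos y → y ≢ - half → z ≡ 1# + y ⊎ z ≡ 1# - y → ¬ (z ≡ half ⊎ z ≡ 1# + half)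
    unexceptional {y} Pos-y y≢-half (inj₁ refl) (inj₁ 1+y≡half) = y≢-half (combine 1# 1+y≡half (combine 1# half+half≡1
      (solve 2 (λ t y → y := :- t :+ # 1 :* (# 1 :+ y :- t) :+ # 1 :* (t :+ t :- # 1)) refl half y)))
    unexceptional {y} Pos-y y≢-half (inj₁ refl) (inj₂ 1+y≡1+half) = ¬Pos-half (subst Pos (combine 1# 1+y≡1+half
      (solve 2 (λ t y → y := t :+ # 1 :* (# 1 :+ y :- (# 1 :+ t))) refl half y)) Pos-y)
    unexceptional {y} Pos-y y≢-half (inj₂ refl) (inj₁ 1-y≡half) = ¬Pos-half (subst Pos (combine (- 1#) 1-y≡half (combine (- 1#) half+half≡1
      (solve 2 (λ t y → y := t :+ (:- # 1) :* (# 1 :- y :- t) :+ (:- # 1) :* (t :+ t :- # 1)) refl half y))) Pos-y)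
    unexceptional {y} Pos-y y≢-half (inj₂ refl) (inj₂ 1-y≡1+half) = y≢-half (combine (- 1#) 1-y≡1+half
      (solve 2 (λ t y → y := :- t :+ (:- # 1) :* (# 1 :- y :- (# 1 :+ t))) refl half y))

    -- Equal signs cancel `c`; opposite signs would make one positive element the negative of
    -- another.
    equal-up-to-sign : ∀ {c x y w} → c ≢ 0# → Pos x → Pos y → c * x ≡ w ⊎ c * x ≡ - w → c * y ≡ w ⊎ c * y ≡ - w → x ≡ y
    equal-up-to-sign c≢0 _ _ (inj₁ p) (inj₁ r) = *-cancelˡ c≢0 (trans p (sym r))
    equal-up-to-sign c≢0 _ _ (inj₂ p) (inj₂ r) = *-cancelˡ c≢0 (trans p (sym r))
    equal-up-to-sign {c} {x} {y} c≢0 Pos-x Pos-y (inj₁ p) (inj₂ r) = contradiction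
      (subst Pos (*-cancelˡ c≢0 (combine 1# r (combine 1# p (solve 4
        (λ c x y w → c :* y := c :* (:- x) :+ # 1 :* (c :* y :- :- w) :+ # 1 :* (c :* x :- w)) refl c x y _)))) Pos-y) (Pos⇒¬Pos- Pos-x)
    equal-up-to-sign {c} {x} {y} c≢0 Pos-x Pos-y (inj₂ p) (inj₁ r) = contradiction
      (subst Pos (*-cancelˡ c≢0 (combine 1# p (combine 1# r (solve 4
        (λ c x y w → c :* x := c :* (:- y) :+ # 1 :* (c :* x :- :- w) :+ # 1 :* (c :* y :- w)) refl c x y _)))) Pos-x) (Pos⇒¬Pos- Pos-y)

    module Construction {e : Carrier} (Pos-e : Pos e) (e≢1 : e ≢ 1#) (2e : e + e ≡ half ⊎ e + e ≡ 1# + half) where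

      f : Carrier → Carrier
      f x with x ≟ 1# | x ≟ e
      ... | yes _ | _ = half
      ... | no _ | yes _ = x - 1#
      ... | no _ | no _ = 1# - x

      f-1 : f 1# ≡ half
      f-1 with 1# ≟ 1#
      ... | yes _ = refl
      ... | no 1≢1 = contradiction refl 1≢1

      f-e : f e ≡ e - 1#
      f-e with e ≟ 1# | e ≟ e
      ... | yes e≡1 | _ = contradiction e≡1 e≢1
      ... | no _ | yes _ = refl
      ... | no _ | no e≢e = contradiction refl e≢e

      f-generic : ∀ {x} → x ≢ 1# → x ≢ e → f x ≡ 1# - x
      f-generic {x} x≢1 x≢e with x ≟ 1# | x ≟ e
      ... | yes x≡1 | _ = contradiction x≡1 x≢1
      ... | no _ | yes x≡e = contradiction x≡e x≢e
      ... | no _ | no _ = refl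

      φ : Carrier → Carrier
      φ = oddExtension Pos? Pos⇒¬Pos- f

      φ-odd : ∀ x → φ (- x) ≡ - φ x
      φ-odd = oddExtension-odd Pos? Pos⇒¬Pos- f

      φ-Pos : ∀ {x} → Pos x → φ x ≡ f x
      φ-Pos = on-P Pos? Pos⇒¬Pos- f

      -- Solving 1 - x = -y gives x = y + 1, positive unless y = -1/2, and that value is supplied by
      -- φ 1 = 1/2. At x = e only the sign differs.
      φ-covers : ∀ y → Pos y → ∃ λ x → φ x ≡ y ⊎ φ x ≡ - y
      φ-covers y Pos-y with y ≟ - half | (y + 1#) ≟ e
      ... | yes refl | _ = 1# , inj₂ (trans (φ-Pos Pos1) (trans f-1 (sym (-‿involutive half))))
      ... | no _ | yes y+1≡e = e , inj₁ (trans (φ-Pos Pos-e) (trans f-e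
        (combine (- 1#) y+1≡e (solve 2 (λ y e → e :- # 1 := y :+ (:- # 1) :* (y :+ # 1 :- e)) refl y e))))
      ... | no y≢-half | no y+1≢e = y + 1# , inj₂ (trans (φ-Pos (Pos-suc Pos-y y≢-half)) (trans (f-generic y+1≢1 y+1≢e)
        (solve 1 (λ y → # 1 :- (y :+ # 1) := :- y) refl y)))
        where
        y+1≢1 : y + 1# ≢ 1#
        y+1≢1 y+1≡1 = ¬Pos0 (subst Pos (combine 1# y+1≡1 (solve 1 (λ y → y := # 0 :+ # 1 :* (y :+ # 1 :- # 1)) refl y)) Pos-y)

      φ-id-generic : ∀ {x y} → Pos y → y ≢ - half → Pos x → x ≢ 1# → x + x ≡ 1# + y ⊎ x + x ≡ 1# - y →
        φ x - x ≡ y ⊎ φ x - x ≡ - y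
      φ-id-generic {x} {y} Pos-y y≢-half Pos-x x≢1 x+x≡1±y = go x+x≡1±y
        where
        φx≡1-x : φ x ≡ 1# - x
        φx≡1-x = trans (φ-Pos Pos-x) (f-generic x≢1 λ { refl → unexceptional Pos-y y≢-half x+x≡1±y 2e })
        go : x + x ≡ 1# + y ⊎ x + x ≡ 1# - y → φ x - x ≡ y ⊎ φ x - x ≡ - y
        go (inj₁ p) = inj₂ (combine 1# φx≡1-x (combine (- 1#) p (solve 3
          (λ v x y → v :- x := :- y :+ # 1 :* (v :- (# 1 :- x)) :+ (:- # 1) :* (x :+ x :- (# 1 :+ y))) refl (φ x) x y)))
        go (inj₂ p) = inj₁ (combine 1# φx≡1-x (combine (- 1#) p (solve 3
          (λ v x y → v :- x := y :+ # 1 :* (v :- (# 1 :- x)) :+ (:- # 1) :* (x :+ x :- (# 1 :- y))) refl (φ x) x y)))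

      -- The two repairs supply φ e - e = -1 and φ 1 - 1 = -1/2. For other y the solutions of 1 - 2x
      -- = -y and 1 - 2x = y are `m` and `1# - m`, one of which is positive.
      φ-id-covers : ∀ y → Pos y → ∃ λ x → φ x - x ≡ y ⊎ φ x - x ≡ - y
      φ-id-covers y Pos-y with y ≟ 1# | y ≟ - half
      ... | yes refl | _ = e , inj₂ (trans (cong (_- e) (trans (φ-Pos Pos-e) f-e)) (solve 1 (λ e → e :- # 1 :- e := :- # 1) refl e))
      ... | no _ | yes refl = 1# , inj₁ (trans (cong (_- 1#) (trans (φ-Pos Pos1) f-1))
        (combine 1# half+half≡1 (solve 1 (λ t → t :- # 1 := :- t :+ # 1 :* (t :+ t :- # 1)) refl half)))
      ... | no y≢1 | no y≢-half = [
        (λ Pos-m → m , φ-id-generic Pos-y y≢-half Pos-m m≢1 (inj₁ m+m≡1+y)) ,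
        (λ Pos-1-m → 1# - m , φ-id-generic Pos-y y≢-half Pos-1-m (complement≢1 m≢0) (inj₂ (combine (- 1#) m+m≡1+y
          (solve 2 (λ m y → # 1 :- m :+ (# 1 :- m) := # 1 :- y :+ (:- # 1) :* (m :+ m :- (# 1 :+ y))) refl m y)))) ]′
        (Pos-or-complement m≢0 m≢half)
        where
        m = half * (1# + y)
        m+m≡1+y : m + m ≡ 1# + y
        m+m≡1+y = combine (1# + y) half+half≡1 (solve 2
          (λ t y → t :* (# 1 :+ y) :+ t :* (# 1 :+ y) := # 1 :+ y :+ (# 1 :+ y) :* (t :+ t :- # 1)) refl half y)
        m≢0 : m ≢ 0#
        m≢0 m≡0 = Pos⇒¬Pos- Pos1 (subst Pos (combine (- 1#) m+m≡1+y (combine (1# + 1#) m≡0 (solve 2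
          (λ m y → y := :- # 1 :+ (:- # 1) :* (m :+ m :- (# 1 :+ y)) :+ (# 1 :+ # 1) :* (m :- # 0)) refl m y))) Pos-y)
        m≢half : m ≢ half
        m≢half m≡half = ¬Pos0 (subst Pos (combine 1# (*-cancelˡ half≢0 (trans m≡half (sym (*-identityʳ half))))
          (solve 1 (λ y → y := # 0 :+ # 1 :* (# 1 :+ y :- # 1)) refl y)) Pos-y)
        m≢1 : m ≢ 1#
        m≢1 m≡1 = y≢1 (combine (- 1#) m+m≡1+y (combine (1# + 1#) m≡1 (solve 2
          (λ m y → y := # 1 :+ (:- # 1) :* (m :+ m :- (# 1 :+ y)) :+ (# 1 :+ # 1) :* (m :- # 1)) refl m y)))

      Generic : Carrier → Set
      Generic x = x ≢ 1# × x ≢ e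

      φ-generic : ∀ {x} → Pos x → Generic x → φ x ≡ 1# - x
      φ-generic Pos-x (x≢1 , x≢e) = trans (φ-Pos Pos-x) (f-generic x≢1 x≢e)

      -- Each obstruction excludes at most one positive x, so one of the four candidates 2, 3, 4, 5 survives all three.
      generic-pair : ∀ {c} → c ≢ 0# → ∃ λ x → Pos x × Generic x ×
        (c * x ≢ 1# × c * x ≢ - 1#) × (c * x ≢ e × c * x ≢ - e)
      generic-pair {c} c≢0 = conclude (∃-unlabelled {3} {4} (ℕ.n<1+n 3) obstructed? unique)
        where
        candidate : Fin 4 → Carrier
        candidate k = ι (suc (suc (toℕ k)))
        in-range : ∀ (k : Fin 4) → suc (toℕ k) < h
        -- The largest candidate is 5, which is positive exactly because `5 ≤ h`.
        in-range k = ℕ.≤-trans (s≤s (toℕ<n k)) 5≤h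
        in-double-range : ∀ (k : Fin 4) → suc (suc (toℕ k)) ≤ h ℕ.+ h
        in-double-range k = ℕ.≤-trans (in-range k) (ℕ.m≤m+n h h)
        Pos-candidate : ∀ k → Pos (candidate k)
        Pos-candidate k = Pos-ι (in-range k)
        candidate-injective : ∀ {k l} → candidate k ≡ candidate l → k ≡ l
        candidate-injective {k} {l} eq = toℕ-injective (ℕ.suc-injective (ℕ.suc-injective
          (ι-injective (in-double-range k) (in-double-range l) eq)))
        candidate≢1 : ∀ k → candidate k ≢ 1#
        candidate≢1 k eq = contradiction
          (ι-injective {suc (suc (toℕ k))} {1} (in-double-range k) (ℕ.≤-trans 0<h (ℕ.m≤m+n h h)) (trans eq (sym (+-identityʳ 1#)))) λ ()
        Obstructed : Fin 4 → Fin 3 → Set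
        Obstructed k zero = candidate k ≡ e
        Obstructed k (suc zero) = c * candidate k ≡ 1# ⊎ c * candidate k ≡ - 1#
        Obstructed k (suc (suc zero)) = c * candidate k ≡ e ⊎ c * candidate k ≡ - e
        obstructed? : ∀ k l → Dec (Obstructed k l)
        obstructed? k zero = candidate k ≟ e
        obstructed? k (suc zero) = ((c * candidate k) ≟ 1#) ⊎-dec ((c * candidate k) ≟ (- 1#))
        obstructed? k (suc (suc zero)) = ((c * candidate k) ≟ e) ⊎-dec ((c * candidate k) ≟ (- e))
        unique : ∀ {k k′ l} → Obstructed k l → Obstructed k′ l → k ≡ k′
        unique {l = zero} p r = candidate-injective (trans p (sym r))
        unique {k} {k′} {suc zero} p r = candidate-injective (equal-up-to-sign c≢0 (Pos-candidate k) (Pos-candidate k′) p r)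
        unique {k} {k′} {suc (suc zero)} p r = candidate-injective (equal-up-to-sign c≢0 (Pos-candidate k) (Pos-candidate k′) p r)
        conclude : (∃ λ k → ∀ l → ¬ Obstructed k l) → ∃ λ x → Pos x × Generic x ×
          (c * x ≢ 1# × c * x ≢ - 1#) × (c * x ≢ e × c * x ≢ - e)
        conclude (k , free) = candidate k , Pos-candidate k , (candidate≢1 k , free zero) ,
          (free (suc zero) ∘ inj₁ , free (suc zero) ∘ inj₂) , (free (suc (suc zero)) ∘ inj₁ , free (suc (suc zero)) ∘ inj₂)

      -- At generic positive points φ x / x = 1 / x - 1 determines x.
      φ-stabiliser : ∀ c → c ≢ 0# → (∀ x → x ≢ 0# → φ (c * x) * x ≡ c * x * φ x) → c ≡ 1# ⊎ c ≡ - 1#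
      φ-stabiliser c c≢0 invariant = compare (generic-pair c≢0)
        where
        compare : (∃ λ x → Pos x × Generic x × (c * x ≢ 1# × c * x ≢ - 1#) × (c * x ≢ e × c * x ≢ - e)) → c ≡ 1# ⊎ c ≡ - 1#
        compare (x , Pos-x , generic-x , (cx≢1 , cx≢-1) , (cx≢e , cx≢-e)) = by-sign (trichotomy (c * x))
          where
          x≢0 : x ≢ 0#
          x≢0 refl = ¬Pos0 Pos-x
          at-x : ∀ {v} → φ (c * x) ≡ v → c * x * (1# - x) ≡ v * x
          at-x refl = sym (trans (invariant x x≢0) (cong (c * x *_) (φ-generic Pos-x generic-x)))
          negated : ∀ {w} → c * x ≢ - w → - (c * x) ≢ w
          negated cx≢-w -cx≡w = cx≢-w (trans (sym (-‿involutive _)) (cong (-_) -cx≡w))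
          by-sign : c * x ≡ 0# ⊎ Pos (c * x) ⊎ Pos (- (c * x)) → c ≡ 1# ⊎ c ≡ - 1#
          by-sign (inj₁ cx≡0) = contradiction cx≡0 (*-≢0 c≢0 x≢0)
          by-sign (inj₂ (inj₁ Pos-cx)) = inj₁ (*-cancelˡ x≢0 (combine 1# (at-x (φ-generic Pos-cx (cx≢1 , cx≢e))) (solve 2
            (λ c x → x :* c := x :* # 1 :+ # 1 :* (c :* x :* (# 1 :- x) :- (# 1 :- c :* x) :* x)) refl c x)))
          by-sign (inj₂ (inj₂ Pos-neg-cx)) = inj₂ (*-cancelˡ x≢0 (combine 1#
            (at-x (trans (on-neg-P Pos? Pos⇒¬Pos- f Pos-neg-cx) (cong (-_) (f-generic (negated cx≢-1) (negated cx≢-e))))) (solve 2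
            (λ c x → x :* c := x :* (:- # 1) :+ # 1 :* (c :* x :* (# 1 :- x) :- (:- (# 1 :- :- (c :* x))) :* x)) refl c x)))

      large-InD : InD g h φ
      large-InD = oddOrthomorphism⇒InD φ-odd 0<h (covers-from-Pos φ-odd φ-covers)
        (covers-from-Pos (OddMap.-id-odd φ-odd) φ-id-covers) φ-stabiliser

-- The orders 3 and 9.

module FieldOfThree (F : FiniteField 3)
  (ι-covers : ∀ x → ∃ λ (i : Fin 3) → FiniteFieldProperties.ι F (toℕ i) ≡ x) where
  open OddOrderField {1} F

  -- Both -x and -2x permute the field, and every non-zero `c` is already 1 or -1.
  negation-InD : ∀ {g} → IsGenerator g → InD g 1 (-_)
  negation-InD g-generates = Generated.oddOrthomorphism⇒InD g-generates (λ _ → refl) (s≤s z≤n)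
    (λ y → - y , -‿involutive y)
    (λ y → - (half * y) , combine y half+half≡1 (solve 2
      (λ t y → :- :- (t :* y) :- :- (t :* y) := y :+ y :* (t :+ t :- # 1)) refl half y))
    (λ c c≢0 _ → unit (ι-covers c) c≢0)
    where
    unit : ∀ {c} → (∃ λ i → ι (toℕ i) ≡ c) → c ≢ 0# → c ≡ 1# ⊎ c ≡ - 1#
    unit (zero , 0≡c) c≢0 = contradiction (sym 0≡c) c≢0
    unit (suc zero , 1≡c) _ = inj₁ (trans (sym 1≡c) (+-identityʳ 1#))
    unit (suc (suc zero) , refl) _ = inj₂ (combine 1# ι-q≡0
      (solve 0 (# 1 :+ (# 1 :+ # 0) := :- # 1 :+ # 1 :* (# 1 :+ (# 1 :+ (# 1 :+ # 0)) :- # 0)) refl))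

-- 3 would be a zero divisor, since 3 · 3 = 9 = 0 while 3 is non-zero.
nine-not-prime : (F : FiniteField 9) → ¬ (∀ x → ∃ λ (i : Fin 9) → FiniteFieldProperties.ι F (toℕ i) ≡ x)
nine-not-prime F ι-covers = *-≢0 3≢0 3≢0 (trans (sym (ι-* 3 3)) ι-q≡0)
  where
  open OddOrderField {4} F
  3≢0 : ι 3 ≢ 0#
  3≢0 = PrimeField.ι-suc≢0 {4} F ι-covers (s≤s (s≤s (s≤s z≤n)))

-- Combining the prime and non-prime cases.

prime-case : ∀ h → h ≢ 2 → h ≢ 3 → (F : FiniteField (suc (h ℕ.+ h))) →
  (∀ x → ∃ λ (i : Fin (suc (h ℕ.+ h))) → FiniteFieldProperties.ι F (toℕ i) ≡ x) →
  ∀ {g} → FiniteField.IsGenerator F g → 0 < h → ∃ λ φ → FiniteField.InD F g h φ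
prime-case 1 _ _ F ι-covers g-generates _ = _ , FieldOfThree.negation-InD F ι-covers g-generates
prime-case 2 2≢2 _ _ _ _ _ = contradiction refl 2≢2
prime-case 3 _ 3≢3 _ _ _ _ = contradiction refl 3≢3
prime-case 4 _ _ F ι-covers _ _ = contradiction ι-covers (nine-not-prime F)
prime-case h@(suc (suc (suc (suc (suc _))))) _ _ F ι-covers g-generates _ = construct exceptional
  where
  open PrimeField {h} F ι-covers
  open Large (s≤s (s≤s (s≤s (s≤s (s≤s z≤n))))) g-generates
  open OddOrderField {h} F
  construct : (∃ λ e → Pos e × e ≢ 1# × (e + e ≡ half ⊎ e + e ≡ 1# + half)) → ∃ λ φ → InD _ h φ
  construct (e , Pos-e , e≢1 , 2e) = _ , Construction.large-InD Pos-e e≢1 2e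

odd-order : ∀ h → h ≢ 2 → h ≢ 3 → (F : FiniteField (suc (h ℕ.+ h))) →
  ∀ {g} → FiniteField.IsGenerator F g → ∃ λ φ → FiniteField.InD F g h φ
odd-order zero _ _ F _ = contradiction (trans (sym (only-element 0#)) (only-element 1#)) 0≢1
  where
  open FiniteFieldProperties F
  only-element : ∀ x → Inverse.to enumeration zero ≡ x
  only-element x with Inverse.from enumeration x | to∘from x
  ... | zero | to-0≡x = to-0≡x
odd-order h@(suc _) h≢2 h≢3 F g-generates with all? (λ j → any? (λ i → ι (toℕ i) ≟ Inverse.to enumeration j))
  where open OddOrderField {h} F
... | yes covered = prime-case h h≢2 h≢3 F
  (λ x → proj₁ (covered (Inverse.from enumeration x)) , trans (proj₂ (covered (Inverse.from enumeration x))) (to∘from x))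
  g-generates (s≤s z≤n)
  where open OddOrderField {h} F
... | no uncovered = _ , NonPrimeField.nonPrime-InD {h} F g-generates (s≤s z≤n) {proj₁ avoided} (proj₂ avoided)
  where
  open OddOrderField {h} F
  avoided : ∃ λ u → ∀ k → ι k ≢ u
  avoided with j , j∉ι ← ¬∀⟶∃¬ _ _ (λ j → any? (λ i → ι (toℕ i) ≟ Inverse.to enumeration j)) uncovered =
    -- The search excludes only indices below q; reducing `k` modulo q excludes them all.
    Inverse.to enumeration j , λ k k≡j → j∉ι (fromℕ< (m%n<n k _) ,
      trans (cong ι (toℕ-fromℕ< (m%n<n k _))) (trans (ι-% k) k≡j))

theorem3p3 : (q : ℕ) → q % 2 ≡ 1 → q ≢ 5 → q ≢ 7 → (F : FiniteField q) →
    (g : FiniteField.Carrier F) → FiniteField.IsGenerator F g →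
    ∃ λ (φ : FiniteField.Carrier F → FiniteField.Carrier F) → FiniteField.InD F g ((q ∸ 1) / 2) φ
theorem3p3 q q-odd q≢5 q≢7 F g g-generates = from-half (q / 2) q≡1+2h F g-generates
  where
  double : ∀ h → h ℕ.* 2 ≡ h ℕ.+ h
  double h = trans (ℕ.*-comm h 2) (cong (h ℕ.+_) (ℕ.+-identityʳ h))
  q≡1+2h : q ≡ suc (q / 2 ℕ.+ q / 2)
  q≡1+2h = trans (m≡m%n+[m/n]*n q 2) (cong₂ ℕ._+_ q-odd (double (q / 2)))
  -- With a variable `h` in place of `q / 2`, matching on `refl` can replace q by `suc (h ℕ.+ h)`,
  -- also in the type of `F`.
  from-half : ∀ h → q ≡ suc (h ℕ.+ h) → (F : FiniteField q) → ∀ {g} → FiniteField.IsGenerator F g →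
    ∃ λ φ → FiniteField.InD F g ((q ∸ 1) / 2) φ
  from-half h refl F {g} g-generates = subst (λ n → ∃ λ φ → FiniteField.InD F g n φ)
    (sym (trans (cong (_/ 2) (sym (double h))) (m*n/n≡m h 2)))
    (odd-order h (λ { refl → q≢5 refl }) (λ { refl → q≢7 refl }) F g-generates)
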